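{- (Strong soundness) For every set $\Pi \subseteq \mathcal{L}$ of formulas and every formula $\varphi \in \mathcal{L}$: if $\Pi \vdash \varphi$, then $\Pi \models \varphi$.
   Context: **Language.** Let $At$ be a countable set of atoms. The language $\mathcal{L}$ is given by $\varphi ::= p \mid \neg\varphi \mid \varphi\wedge\varphi \mid \mathcal{R}(\varphi) \mid \varphi \Rrightarrow \varphi$ with $p\in At$; other propositional connectives are defined as usual. Abbreviations: $\bot := \varphi_0\wedge\neg\varphi_0$ (for a fixed formula $\varphi_0$), $\top := \neg\bot$, $\Box\varphi := \top\Rrightarrow\varphi$, $\lozenge\varphi := \neg\Box\neg\varphi$. **Semantics.** A model is $\mathcal{M}=(X,\mathcal{T},v)$ where $X\neq\emptyset$ is a set, $\mathcal{T}$ is a topology on $X$, and $v:At\to\mathcal{P}(X)$. Let $\mathrm{int}(A)=\bigcup\{O\in\mathcal{T}: O\subseteq A\}$ and $||\varphi||^{\mathcal{M}}=\{s\in X:\mathcal{M},s\models\varphi\}$. Satisfaction at $s\in X$: $\mathcal{M},s\models p$ iff $s\in v(p)$; $\neg,\wedge$ are interpreted classically; $\mathcal{M},s\models\mathcal{R}\varphi$ iff $s\in\mathrm{int}(||\varphi||^{\mathcal{M}})$; $\mathcal{M},s\models\varphi\Rrightarrow\psi$ iff $\emptyset\neq\mathrm{int}(||\varphi||^{\mathcal{M}})\subseteq||\psi||^{\mathcal{M}}$. $\Pi\models\varphi$ means: for every model $\mathcal{M}$ and every state $s$ of $\mathcal{M}$, if $\mathcal{M},s\models\psi$ for all $\psi\in\Pi$,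 then $\mathcal{M},s\models\varphi$. **Proof system.** Axiom schemes: - (CL) all instances of classical propositional tautologies; - (K-R) $\mathcal{R}(\varphi\to\psi)\to(\mathcal{R}\varphi\to\mathcal{R}\psi)$; - (4) $\mathcal{R}\varphi\to\mathcal{R}\mathcal{R}\varphi$; - (K-RC) $(\varphi\Rrightarrow(\psi\to\chi))\to((\varphi\Rrightarrow\psi)\to(\varphi\Rrightarrow\chi))$; - (Abs) $\lozenge(\varphi\Rrightarrow\psi)\to\Box(\varphi\Rrightarrow\psi)$; - (RMP) $(\mathcal{R}\varphi\wedge(\varphi\Rrightarrow\psi))\to\psi$; - (Dis) $(\varphi\Rrightarrow\psi)\to(\varphi\Rrightarrow\mathcal{R}\psi)$; - (Mon) $\lozenge\mathcal{R}(\varphi\wedge\chi)\to((\varphi\Rrightarrow\psi)\to((\varphi\wedge\chi)\Rrightarrow\psi))$; - (NV) $(\varphi\Rrightarrow\psi)\to\lozenge\mathcal{R}\varphi$. Rules: (MP) from $\varphi$ and $\varphi\to\psi$ infer $\psi$; (RCI) from $\varphi\to\psi$ infer $\lozenge\mathcal{R}\varphi\to(\varphi\Rrightarrow\psi)$; (N$_{\mathcal{R}}$) from $\varphi$ infer $\mathcal{R}\varphi$. A derivation of $\varphi_n$ is a finite sequence $\varphi_1,\dots,\varphi_n$ in which each formula is an axiom instance or follows from earlier ones by a rule; $\vdash\varphi$ means a derivation of $\varphi$ exists. $\Gamma\vdash\varphi$ means that $\vdash\varphi$ or $\vdash(\psi_1\wedge\dots\wedge\psi_n)\to\varphi$ for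 some $\psi_1,\dots,\psi_n\in\Gamma$. -}

module Defs where

open import Level using (Level; Lift; suc; _⊔_)
open import Data.Bool.Base using (Bool; true; not) renaming (_∧_ to _∧ᵇ_)
open import Data.List.Base using (List; []; _∷_)
open import Data.List.NonEmpty.Base using (List⁺; foldr₁; toList)
open import Data.List.Membership.Propositional using () renaming (_∈_ to _∈ˡ_)
open import Data.List.Relation.Unary.All using (All)
open import Data.Nat.Base using (ℕ)
open import Data.Product.Base using (∃; ∃-syntax; _×_)
open import Data.Sum.Base using (_⊎_)
open import Relation.Binary.PropositionalEquality.Core using (_≡_)
open import Relation.Nullary.Negation.Core using (¬_)
open import Relation.Unary using (Pred; _∈_; _⊆_; _≐_; _∩_; Satisfiable)
open import Relation.Unary.Polymorphic using (∅; U)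

private
  variable
    a m p ℓ : Level
    At : Set a

infix  8 ¬ᶠ_
infixr 7 _∧ᶠ_
infixr 6 _⇛_
infixr 5 _⇒ᶠ_

data Formula (At : Set a) : Set a where
  atom : At → Formula At
  ¬ᶠ_  : Formula At → Formula At
  _∧ᶠ_ : Formula At → Formula At → Formula At
  R    : Formula At → Formula At
  _⇛_  : Formula At → Formula At → Formula At

_⇒ᶠ_ : Formula At → Formula At → Formula At
φ ⇒ᶠ ψ = ¬ᶠ (φ ∧ᶠ ¬ᶠ ψ)

-- Propositional formulas over the primitive connectives of the language.
-- Since _⇒ᶠ_ is an abbreviation, these schemes cover all connectives.

data PropFormula : Set where
  var  : ℕ → PropFormula
  ¬ᵖ_  : PropFormula → PropFormula
  _∧ᵖ_ : PropFormula → PropFormula → PropFormula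

eval : (ℕ → Bool) → PropFormula → Bool
eval ρ (var i)  = ρ i
eval ρ (¬ᵖ θ)   = not (eval ρ θ)
eval ρ (θ ∧ᵖ η) = eval ρ θ ∧ᵇ eval ρ η

Tautology : PropFormula → Set
Tautology θ = ∀ ρ → eval ρ θ ≡ true

_[_] : PropFormula → (ℕ → Formula At) → Formula At
var i    [ σ ] = σ i
(¬ᵖ θ)   [ σ ] = ¬ᶠ (θ [ σ ])
(θ ∧ᵖ η) [ σ ] = (θ [ σ ]) ∧ᶠ (η [ σ ])

-- φ₀ is the fixed formula used to define falsum; it is a parameter because
-- the language has no constant (and no formula at all if there are no atoms).

module Calculus {a} {At : Set a} (φ₀ : Formula At) where

  ⊥ᶠ ⊤ᶠ : Formula At
  ⊥ᶠ = φ₀ ∧ᶠ ¬ᶠ φ₀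
  ⊤ᶠ = ¬ᶠ ⊥ᶠ

  □ ◇ : Formula At → Formula At
  □ φ = ⊤ᶠ ⇛ φ
  ◇ φ = ¬ᶠ (□ (¬ᶠ φ))

  data Axiom : Formula At → Set a where
    CL   : ∀ θ (σ : ℕ → Formula At) → Tautology θ → Axiom (θ [ σ ])
    K-R  : ∀ φ ψ → Axiom (R (φ ⇒ᶠ ψ) ⇒ᶠ (R φ ⇒ᶠ R ψ))
    4-R  : ∀ φ → Axiom (R φ ⇒ᶠ R (R φ))
    K-RC : ∀ φ ψ χ → Axiom ((φ ⇛ (ψ ⇒ᶠ χ)) ⇒ᶠ ((φ ⇛ ψ) ⇒ᶠ (φ ⇛ χ)))
    Abs  : ∀ φ ψ → Axiom (◇ (φ ⇛ ψ) ⇒ᶠ □ (φ ⇛ ψ))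
    RMP  : ∀ φ ψ → Axiom ((R φ ∧ᶠ (φ ⇛ ψ)) ⇒ᶠ ψ)
    Dis  : ∀ φ ψ → Axiom ((φ ⇛ ψ) ⇒ᶠ (φ ⇛ R ψ))
    Mon  : ∀ φ ψ χ →
           Axiom (◇ (R (φ ∧ᶠ χ)) ⇒ᶠ ((φ ⇛ ψ) ⇒ᶠ ((φ ∧ᶠ χ) ⇛ ψ)))
    NV   : ∀ φ ψ → Axiom ((φ ⇛ ψ) ⇒ᶠ ◇ (R φ))

  data Justified (earlier : List (Formula At)) : Formula At → Set a where
    axiom : ∀ {φ} → Axiom φ → Justified earlier φ
    MP    : ∀ {φ ψ} → φ ∈ˡ earlier → (φ ⇒ᶠ ψ) ∈ˡ earlier →
            Justified earlier ψ
    RCI   : ∀ {φ ψ} → (φ ⇒ᶠ ψ) ∈ˡ earlier →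
            Justified earlier (◇ (R φ) ⇒ᶠ (φ ⇛ ψ))
    N-R   : ∀ {φ} → φ ∈ˡ earlier → Justified earlier (R φ)

  -- Derivations are listed in reverse: the head is the last formula derived.

  data Derivation : List (Formula At) → Set a where
    []  : Derivation []
    _∷_ : ∀ {φ φs} → Justified φs φ → Derivation φs → Derivation (φ ∷ φs)

  infix 4 ⊢_ _⊢_

  ⊢_ : Formula At → Set a
  ⊢ φ = ∃[ φs ] Derivation (φ ∷ φs)

  ⋀ : List⁺ (Formula At) → Formula At
  ⋀ = foldr₁ _∧ᶠ_

  _⊢_ : Pred (Formula At) p → Formula At → Set (a ⊔ p)
  Γ ⊢ φ = (⊢ φ) ⊎ (∃[ ψs ] All (_∈ Γ) (toList ψs) × (⊢ (⋀ ψs ⇒ᶠ φ)))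

⋃ : {X : Set ℓ} → Pred (Pred X ℓ) m → Pred X (suc ℓ ⊔ m)
⋃ 𝒮 x = ∃[ O ] O ∈ 𝒮 × x ∈ O

-- The union of a family of ℓ-small subsets lives one universe up, so closure
-- under unions is stated for every ℓ-small subset coinciding with that union.
-- Under excluded middle such a subset always exists.  Singleton families
-- show that openness respects extensional equality of subsets.

record Topology (X : Set ℓ) : Set (suc (suc ℓ)) where
  field
    Open   : Pred (Pred X ℓ) (suc ℓ)
    ∅-open : ∅ ∈ Open
    U-open : U ∈ Open
    ∩-open : ∀ {O P} → O ∈ Open → P ∈ Open → O ∩ P ∈ Open
    ⋃-open : ∀ (𝒮 : Pred (Pred X ℓ) (suc ℓ)) → 𝒮 ⊆ Open →
             ∀ V → V ≐ ⋃ 𝒮 → V ∈ Open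

  int : Pred X m → Pred X (suc ℓ ⊔ m)
  int A = ⋃ (λ O → O ∈ Open × O ⊆ A)

record Model (At : Set a) (ℓ : Level) : Set (a ⊔ suc (suc ℓ)) where
  field
    X        : Set ℓ
    nonempty : X
    topology : Topology X
    v        : At → Pred X ℓ

  open Topology topology public

infix 4 _,_⊨_ _⊨[_]_

_,_⊨_ : (M : Model At ℓ) → Model.X M → Formula At → Set (suc ℓ)
truthSet : (M : Model At ℓ) → Formula At → Pred (Model.X M) (suc ℓ)

truthSet M φ s = M , s ⊨ φ

_,_⊨_ {ℓ = ℓ} M s (atom q) = Lift (suc ℓ) (s ∈ Model.v M q)
M , s ⊨ ¬ᶠ φ   = ¬ (M , s ⊨ φ)
M , s ⊨ φ ∧ᶠ ψ = (M , s ⊨ φ) × (M , s ⊨ ψ)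
M , s ⊨ R φ    = s ∈ Model.int M (truthSet M φ)
M , s ⊨ φ ⇛ ψ  = Satisfiable (Model.int M (truthSet M φ)) ×
                 Model.int M (truthSet M φ) ⊆ truthSet M ψ

_⊨[_]_ : {At : Set a} → Pred (Formula At) p → (ℓ : Level) → Formula At →
         Set (a ⊔ p ⊔ suc (suc ℓ))
_⊨[_]_ {At = At} Π ℓ φ =
  (M : Model At ℓ) (s : Model.X M) → (∀ ψ → ψ ∈ Π → M , s ⊨ ψ) → M , s ⊨ φ

{-# OPTIONS --safe #-}
module Submission where

open import Defs
open import Level using (Level; suc)
open import Axiom.ExcludedMiddle using (ExcludedMiddle)
open import Function.Bundles using (_↣_)
open import Data.Nat.Base using (ℕ)
open import Relation.Unary using (Pred)
open import Data.List.Base using ([]; _∷_)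
open import Data.List.NonEmpty.Base using (_∷_; toList)
open import Data.List.Relation.Unary.Any using (here)
open import Data.List.Relation.Unary.All using (All; []; _∷_; lookup; map)
open import Data.Product.Base using (_,_; proj₁; proj₂)
open import Data.Sum.Base using (inj₁; inj₂)
open import Function.Base using (_∘_)
open import Relation.Binary.PropositionalEquality.Core using (refl; subst)
open import Relation.Nullary.Decidable using (does; proof; decidable-stable)
open import Relation.Nullary.Reflects using (Reflects; ¬-reflects; _×-reflects_; invert)
open import Relation.Unary using (_∈_; _⊆_; Satisfiable)

-- The points of X at which φ ⇛ ψ holds are all or none, and ◇ φ says that φ is
-- satisfiable, since int X = X.  The axioms for R and ⇛ then only use that
-- int is deflationary, idempotent, monotone and meet-preserving.

module _ {ℓ m : Level} {X : Set ℓ} (𝒯 : Topology X) where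
  open Topology 𝒯

  int-deflationary : {A : Pred X m} → int A ⊆ A
  int-deflationary (_ , (_ , O⊆A) , x∈O) = O⊆A x∈O

  -- An open set witnessing a point of `int A` lies inside `int A`, hence inside `B`, and so serves
  -- again as witness. Taking `B` to be `int A` gives idempotence; composing with `int-deflationary`
  -- gives monotonicity.
  int-greatest : ∀ {n} {A : Pred X m} {B : Pred X n} → int A ⊆ B → int A ⊆ int B
  int-greatest intA⊆B (O , (O-open , O⊆A) , x∈O) =
    O , (O-open , λ y∈O → intA⊆B (O , (O-open , O⊆A) , y∈O)) , x∈O

  int-universal : {A : Pred X m} → (∀ x → x ∈ A) → ∀ x → x ∈ int A
  int-universal all x = _ , (U-open , λ {y} _ → all y) , _

  int-∩ : ∀ {n k} {A : Pred X m} {B : Pred X n} {C : Pred X k} →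
          (∀ {x} → x ∈ A → x ∈ B → x ∈ C) →
          ∀ {x} → x ∈ int A → x ∈ int B → x ∈ int C
  int-∩ f (_ , (O-open , O⊆A) , x∈O) (_ , (P-open , P⊆B) , x∈P) =
    _ , (∩-open O-open P-open , λ (y∈O , y∈P) → f (O⊆A y∈O) (P⊆B y∈P)) , x∈O , x∈P

module _ {a ℓ : Level} {At : Set a} (em : ExcludedMiddle (suc ℓ)) (φ₀ : Formula At)
         (M : Model At ℓ) where
  open Model M
  open Calculus φ₀

  Valid : Formula At → Set _
  Valid φ = ∀ s → M , s ⊨ φ

  ⇒-intro : ∀ φ ψ {s} → (M , s ⊨ φ → M , s ⊨ ψ) → M , s ⊨ φ ⇒ᶠ ψ
  ⇒-intro φ ψ f (p , ¬q) = ¬q (f p)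

  -- A negated conjunction yields only the double negation of `ψ`; excluded middle, at the level
  -- where satisfaction lives, removes it.
  ⇒-elim : ∀ φ ψ {s} → M , s ⊨ φ ⇒ᶠ ψ → M , s ⊨ φ → M , s ⊨ ψ
  ⇒-elim φ ψ h p = decidable-stable em λ ¬q → h (p , ¬q)

  ⊤-valid : Valid ⊤ᶠ
  ⊤-valid s (p , ¬p) = ¬p p

  □-intro : ∀ φ {s} → Valid φ → M , s ⊨ □ φ
  □-intro φ φ-valid =
    (nonempty , int-universal topology ⊤-valid nonempty) , λ {x} _ → φ-valid x

  ◇-intro : ∀ φ {s x} → M , x ⊨ φ → M , s ⊨ ◇ φ
  ◇-intro φ {x = x} p (_ , h) = h (int-universal topology ⊤-valid x) p

  -- Were there no witness, `¬ᶠ φ` would hold everywhere and so be boxed, against `h`.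
  ◇-elim : ∀ φ {s} → M , s ⊨ ◇ φ → Satisfiable (truthSet M φ)
  ◇-elim φ {s} h = decidable-stable em λ ¬∃ →
    h (□-intro (¬ᶠ φ) {s} λ x p → ¬∃ (x , p))

  ◇R-elim : ∀ φ {s} → M , s ⊨ ◇ (R φ) → Satisfiable (int (truthSet M φ))
  ◇R-elim φ {s} = ◇-elim (R φ) {s}

  -- Each variable gets the truth value at `s` of the formula substituted for it, as decided by
  -- excluded middle. A tautology is true under this valuation in particular.
  substitution-reflects : ∀ (σ : ℕ → Formula At) s θ →
    Reflects (M , s ⊨ θ [ σ ]) (eval (λ i → does (em {M , s ⊨ σ i})) θ)
  substitution-reflects σ s (var i)  = proof em
  substitution-reflects σ s (¬ᵖ θ)   = ¬-reflects (substitution-reflects σ s θ)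
  substitution-reflects σ s (θ ∧ᵖ η) =
    substitution-reflects σ s θ ×-reflects substitution-reflects σ s η

  axiom-valid : ∀ {φ} → Axiom φ → Valid φ
  axiom-valid (CL θ σ taut) s =
    invert (subst (Reflects _) (taut _) (substitution-reflects σ s θ))
  axiom-valid (K-R φ ψ) s =
    ⇒-intro (R (φ ⇒ᶠ ψ)) (R φ ⇒ᶠ R ψ) λ h →
    ⇒-intro (R φ) (R ψ) (int-∩ topology (⇒-elim φ ψ) h)
  axiom-valid (4-R φ) s =
    ⇒-intro (R φ) (R (R φ)) (int-greatest topology λ x∈int → x∈int)
  axiom-valid (K-RC φ ψ χ) s =
    ⇒-intro (φ ⇛ (ψ ⇒ᶠ χ)) ((φ ⇛ ψ) ⇒ᶠ (φ ⇛ χ)) {s} λ (_ , f) →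
    ⇒-intro (φ ⇛ ψ) (φ ⇛ χ) {s} λ (sat , g) →
    sat , λ x∈int → ⇒-elim ψ χ (f x∈int) (g x∈int)
  axiom-valid (Abs φ ψ) s =
    ⇒-intro (◇ (φ ⇛ ψ)) (□ (φ ⇛ ψ)) {s} λ h →
    -- Satisfaction of `φ ⇛ ψ` does not mention the state, so the evidence found at one state serves
    -- at all.
    □-intro (φ ⇛ ψ) {s} λ _ → proj₂ (◇-elim (φ ⇛ ψ) {s} h)
  axiom-valid (RMP φ ψ) s =
    ⇒-intro (R φ ∧ᶠ (φ ⇛ ψ)) ψ λ (s∈int , (_ , f)) → f s∈int
  axiom-valid (Dis φ ψ) s =
    ⇒-intro (φ ⇛ ψ) (φ ⇛ R ψ) {s} λ (sat , f) → sat , int-greatest topology f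
  axiom-valid (Mon φ ψ χ) s =
    ⇒-intro (◇ (R (φ ∧ᶠ χ))) ((φ ⇛ ψ) ⇒ᶠ ((φ ∧ᶠ χ) ⇛ ψ)) {s} λ h →
    ⇒-intro (φ ⇛ ψ) ((φ ∧ᶠ χ) ⇛ ψ) {s} λ (_ , f) →
    ◇R-elim (φ ∧ᶠ χ) {s} h ,
    -- By monotonicity the interior for `φ ∧ᶠ χ` lies in the interior for `φ`, where `f` applies.
    f ∘ int-greatest topology (proj₁ ∘ int-deflationary topology)
  axiom-valid (NV φ ψ) s =
    ⇒-intro (φ ⇛ ψ) (◇ (R φ)) {s} λ ((_ , x∈int) , _) → ◇-intro (R φ) {s} x∈int

  -- The invariant is truth at every state of the model: `RCI` and `N-R` use their premise at states
  -- other than `s`.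
  justified-valid : ∀ {φs φ} → All Valid φs → Justified φs φ → Valid φ
  justified-valid vs (axiom ax) = axiom-valid ax
  justified-valid vs (MP {φ} {ψ} φ∈ φ⇒ψ∈) s =
    ⇒-elim φ ψ (lookup vs φ⇒ψ∈ s) (lookup vs φ∈ s)
  justified-valid vs (RCI {φ} {ψ} φ⇒ψ∈) s =
    ⇒-intro (◇ (R φ)) (φ ⇛ ψ) {s} λ h →
    ◇R-elim φ {s} h ,
    λ {x} x∈int → ⇒-elim φ ψ (lookup vs φ⇒ψ∈ x) (int-deflationary topology x∈int)
  justified-valid vs (N-R φ∈) = int-universal topology (lookup vs φ∈)

  derivation-valid : ∀ {φs} → Derivation φs → All Valid φs
  derivation-valid []      = []
  derivation-valid (j ∷ d) = justified-valid vs j ∷ vs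
    where vs = derivation-valid d

  ⊢⇒valid : ∀ {φ} → ⊢ φ → Valid φ
  ⊢⇒valid (_ , d) = lookup (derivation-valid d) (here refl)

  ⋀-intro : ∀ {s} ψs → All (M , s ⊨_) (toList ψs) → M , s ⊨ ⋀ ψs
  ⋀-intro (ψ ∷ [])      (p ∷ [])     = p
  ⋀-intro (ψ ∷ χ ∷ ψs)  (p ∷ q ∷ ps) = p , ⋀-intro (χ ∷ ψs) (q ∷ ps)

theorem5p12 : ∀ {a p ℓ : Level} → ExcludedMiddle (suc ℓ) →
    (At : Set a) → At ↣ ℕ → (φ₀ : Formula At) →
    (Π : Pred (Formula At) p) (φ : Formula At) →
    Calculus._⊢_ φ₀ Π φ → Π ⊨[ ℓ ] φ
theorem5p12 em At _ φ₀ Π φ (inj₁ ⊢φ) M s _ = ⊢⇒valid em φ₀ M ⊢φ s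
theorem5p12 em At _ φ₀ Π φ (inj₂ (ψs , ψs⊆Π , ⊢ψs⇒φ)) M s s⊨Π =
  -- Derivations carry no hypotheses, so the implication is valid in `M`; the formulas of `Π` enter
  -- only through its antecedent, at the given `s`.
  ⇒-elim em φ₀ M (Calculus.⋀ φ₀ ψs) φ (⊢⇒valid em φ₀ M ⊢ψs⇒φ s)
    (⋀-intro em φ₀ M ψs (map (s⊨Π _) ψs⊆Π))
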